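{- Fix integers $d\ge 1$ and $n\ge 1$. There exists a bijection $\phi_d:\mathcal{H}_n\to\mathcal{H}_n$ such that $\mathrm{dif}_d(\lambda)\ge\mathrm{mod}'_d(\phi_d(\lambda))$ for every $\lambda\in\mathcal{H}_n$. Moreover, for every $\lambda\in\mathcal{H}_n$, $\mathrm{dif}_d(\lambda)=0$ if and only if $\mathrm{mod}'_d(\phi_d(\lambda))=0$.
   Context: A partition is a finite nonempty weakly decreasing sequence $\lambda=(\lambda_1,\ldots,\lambda_k)$ of positive integers; $\ell(\lambda)=k$. The perimeter is $\Gamma(\lambda)=\lambda_1+\ell(\lambda)-1$; $\mathcal{H}_n$ is the set of partitions with perimeter $n$. $\mathrm{dif}_d(\lambda)=|\{i:1\le i<\ell(\lambda),\ \lambda_i-\lambda_{i+1}<d\}|$ and $\mathrm{mod}'_d(\lambda)=|\{i:1\le i\le\ell(\lambda),\ \lambda_i\not\equiv 1\pmod{d+1}\}|$. -}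

module Defs where

open import Data.List using (length; filter; zip)
open import Data.List.NonEmpty as List⁺ using (List⁺; toList)
open import Data.List.Relation.Unary.All using (All)
open import Data.List.Relation.Unary.Linked using (Linked)
open import Data.Nat using (ℕ; suc; _+_; _∸_; _≥_; _<?_; _≟_)
open import Data.Nat.DivMod using (_%_)
open import Data.Product using (Σ; _,_)
open import Relation.Binary.PropositionalEquality using (_≡_)
open import Relation.Nullary.Decidable using (¬?)

-- All fields but `parts` are proof-irrelevant propositions, so _≡_ on
-- Partition and on H n is equality of the underlying sequences.
record Partition : Set where
  field
    parts      : List⁺ ℕ
    positive   : All (_≥ 1) (toList parts)
    decreasing : Linked _≥_ (toList parts)

open Partition public

ℓ : Partition → ℕ
ℓ p = List⁺.length (parts p)

-- Never truncated, as the length is at least 1.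
Γ : Partition → ℕ
Γ p = List⁺.head (parts p) + ℓ p ∸ 1

H : ℕ → Set
H n = Σ Partition λ p → Γ p ≡ n

-- The zip lists the pairs (λᵢ , λᵢ₊₁) for 1 ≤ i < ℓ(λ), one per index i;
-- the subtraction is never truncated because the parts decrease weakly.
dif : ℕ → Partition → ℕ
dif d p =
  length (filter (λ (a , b) → a ∸ b <? d)
                 (zip (toList (parts p)) (List⁺.tail (parts p))))

mod′ : ℕ → Partition → ℕ
mod′ d p =
  length (filter (λ a → ¬? (a % suc d ≟ 1 % suc d)) (toList (parts p)))

{-# OPTIONS --safe #-}

-- Record a partition of perimeter m + 1 by a word of length m telling how its
-- Young diagram grows from the single cell: a letter either widens the largest
-- part by one or repeats it.  Run through such a word while writing another one,
-- copying a letter when the largest part written so far is ≢ 1 (mod d + 1) and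
-- exchanging the two letters otherwise.  The output determines which of the two
-- happens at each position, so this is a bijection.
--
-- Let s be the number of widenings after which the largest part written becomes
-- ≡ 1 (mod d + 1), and g the number of widenings after which the largest part
-- read exceeds the next one by at least d.  Then s ≤ g throughout, so whenever a
-- part ≢ 1 (mod d + 1) is written, a gap smaller than d is read; and s = g as
-- long as no such part has been completed.
module Submission where

open import Defs
open import Data.List as List using (List; []; _∷_; filter; zip)
open import Data.List.NonEmpty using (List⁺; _∷_; head; tail; toList)
open import Data.List.Properties using (filter-accept; filter-reject)
open import Data.List.Relation.Unary.All as All using (All; []; _∷_)
open import Data.List.Relation.Unary.Linked as Linked using (Linked; [-]; _∷_)
open import Data.Nat using (ℕ; zero; suc; pred; _+_; _*_; _∸_; _⊓_; _≤_; _≥_; _<?_; _≟_; z≤n; s≤s; s≤s⁻¹)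
open import Data.Nat.DivMod using (_%_; %-distribˡ-+; [m+kn]%n≡m%n; m*n%n≡0; m<n⇒m%n≡m)
open import Data.Nat.Properties
open import Data.Product using (Σ; ∃; _×_; _,_; proj₁; proj₂)
open import Data.Vec using (Vec; []; _∷_)
open import Function.Base using (_∘_)
open import Function.Bundles using (_⤖_; _⇔_; _↔_; mk⇔; mk↔ₛ′; module Bijection; module Inverse)
open import Function.Construct.Composition using (_↔-∘_)
open import Function.Construct.Symmetry using (↔-sym)
open import Function.Properties.Inverse using (↔⇒⤖)
open import Relation.Binary.Definitions using (tri<; tri≈; tri>)
open import Relation.Binary.PropositionalEquality using (_≡_; _≢_; refl; sym; trans; cong; cong₂; subst; module ≡-Reasoning)
open import Relation.Nullary using (contradiction)
open import Relation.Nullary.Decidable using (¬?)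
open import Relation.Unary using (Pred; Decidable)

-- Partitions as growth words

data Step : Set where
  widen repeat : Step

-- The head of a word is its last letter.
Word : ℕ → Set
Word = Vec Step

grow : Step → List⁺ ℕ → List⁺ ℕ
grow widen  (c ∷ xs) = suc c ∷ xs
grow repeat (c ∷ xs) = c ∷ c ∷ xs

shape : ∀ {m} → Word m → List⁺ ℕ
shape []      = 1 ∷ []
shape (a ∷ w) = grow a (shape w)

grow-positive : ∀ a xs → All (_≥ 1) (toList xs) → All (_≥ 1) (toList (grow a xs))
grow-positive widen  (_ ∷ _) (_ ∷ ps) = s≤s z≤n ∷ ps
grow-positive repeat (_ ∷ _) (p ∷ ps) = p ∷ p ∷ ps

grow-decreasing : ∀ a xs → Linked _≥_ (toList xs) → Linked _≥_ (toList (grow a xs))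
grow-decreasing widen  (_ ∷ [])    _        = [-]
grow-decreasing widen  (_ ∷ _ ∷ _) (q ∷ qs) = m≤n⇒m≤1+n q ∷ qs
grow-decreasing repeat (_ ∷ _)     qs       = ≤-refl ∷ qs

shape-positive : ∀ {m} (w : Word m) → All (_≥ 1) (toList (shape w))
shape-positive []      = ≤-refl ∷ []
shape-positive (a ∷ w) = grow-positive a (shape w) (shape-positive w)

shape-decreasing : ∀ {m} (w : Word m) → Linked _≥_ (toList (shape w))
shape-decreasing []      = [-]
shape-decreasing (a ∷ w) = grow-decreasing a (shape w) (shape-decreasing w)

size : List⁺ ℕ → ℕ
size (c ∷ xs) = c + List.length xs

Γ≡size : ∀ p → Γ p ≡ size (parts p)
Γ≡size record { parts = c ∷ xs } = cong pred (+-suc c (List.length xs))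

size-grow : ∀ a xs → size (grow a xs) ≡ suc (size xs)
size-grow widen  (_ ∷ _)  = refl
size-grow repeat (c ∷ xs) = +-suc c (List.length xs)

size-shape : ∀ {m} (w : Word m) → size (shape w) ≡ suc m
size-shape []      = refl
size-shape (a ∷ w) = trans (size-grow a (shape w)) (cong suc (size-shape w))

-- The last letter is read off the top: two equal largest parts come from `repeat`, a strict descent
-- or a single part above 1 from `widen`.
shape-surjective : ∀ m xs → All (_≥ 1) (toList xs) → Linked _≥_ (toList xs) →
                   size xs ≡ suc m → ∃ λ (w : Word m) → shape w ≡ xs
shape-surjective zero (1 ∷ []) _ _ _ = [] , refl
shape-surjective zero (zero ∷ _ ∷ _) (() ∷ _) _ _
shape-surjective zero (suc c ∷ _ ∷ _) _ _ eq =
  contradiction (trans (sym (+-suc c _)) (suc-injective eq)) λ ()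
shape-surjective (suc m) (suc (suc c) ∷ []) _ _ eq
  with w , w≡ ← shape-surjective m (suc c ∷ []) (s≤s z≤n ∷ []) [-] (suc-injective eq)
  = widen ∷ w , cong (grow widen) w≡
shape-surjective (suc m) (c ∷ x ∷ xs) (p ∷ px ∷ ps) (x≤c ∷ qs) eq with <-cmp c x
... | tri< c<x _ _ = contradiction x≤c (<⇒≱ c<x)
... | tri≈ _ refl _
  with w , w≡ ← shape-surjective m (c ∷ xs) (p ∷ ps) qs
                  (suc-injective (trans (sym (+-suc c _)) eq))
  = repeat ∷ w , cong (grow repeat) w≡
shape-surjective (suc m) (suc c ∷ x ∷ xs) (p ∷ px ∷ ps) (x≤c ∷ qs) eq | tri> _ _ x<c
  with w , w≡ ← shape-surjective m (c ∷ x ∷ xs) (≤-trans px (s≤s⁻¹ x<c) ∷ px ∷ ps)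
                  (s≤s⁻¹ x<c ∷ qs) (suc-injective eq)
  = widen ∷ w , cong (grow widen) w≡

grow-injective : ∀ a xs ys → grow a xs ≡ grow a ys → xs ≡ ys
grow-injective widen  (_ ∷ _) (_ ∷ _) refl = refl
grow-injective repeat (_ ∷ _) (_ ∷ _) refl = refl

-- `repeat` leaves the two largest parts equal, whereas widening a decreasing sequence makes the
-- first descent strict.
widen≢repeat : ∀ xs ys → Linked _≥_ (toList xs) → grow widen xs ≢ grow repeat ys
widen≢repeat (_ ∷ _ ∷ _) (_ ∷ _) (q ∷ _) refl = <-irrefl refl q

shape-injective : ∀ {m} (v w : Word m) → shape v ≡ shape w → v ≡ w
shape-injective [] [] _ = refl
shape-injective (widen ∷ v) (widen ∷ w) eq =
  cong (widen ∷_) (shape-injective v w (grow-injective widen _ _ eq))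
shape-injective (repeat ∷ v) (repeat ∷ w) eq =
  cong (repeat ∷_) (shape-injective v w (grow-injective repeat _ _ eq))
shape-injective (widen ∷ v) (repeat ∷ w) eq =
  contradiction eq (widen≢repeat (shape v) (shape w) (shape-decreasing v))
shape-injective (repeat ∷ v) (widen ∷ w) eq =
  contradiction (sym eq) (widen≢repeat (shape w) (shape v) (shape-decreasing w))

H-≡ : ∀ {n} (p q : H n) → parts (proj₁ p) ≡ parts (proj₁ q) → p ≡ q
H-≡ (record { positive = a ; decreasing = b } , e)
    (record { positive = a′ ; decreasing = b′ } , e′) refl
  with refl ← All.irrelevant ≤-irrelevant a a′
     | refl ← Linked.irrelevant ≤-irrelevant b b′
  = cong (_ ,_) (≡-irrelevant e e′)

fromWord : ∀ {m} → Word m → H (suc m)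
fromWord w = p , trans (Γ≡size p) (size-shape w)
  where
  p : Partition
  p = record
    { parts = shape w ; positive = shape-positive w ; decreasing = shape-decreasing w }

Word↔H : ∀ m → Word m ↔ H (suc m)
Word↔H m = mk↔ₛ′ fromWord (proj₁ ∘ word)
  (λ p → H-≡ (fromWord (proj₁ (word p))) p (proj₂ (word p)))
  (λ w → shape-injective _ w (proj₂ (word (fromWord w))))
  where
  word : (p : H (suc m)) → ∃ λ (w : Word m) → shape w ≡ parts (proj₁ p)
  word (p , eq) = shape-surjective m (parts p) (positive p) (decreasing p)
                    (trans (sym (Γ≡size p)) eq)

-- Writing the contribution of `x` as `1 ⊓ k` lets monotonicity of `⊓` compare the two statistics.
length-filter-∷ : ∀ {a p} {A : Set a} {P : Pred A p} (P? : Decidable P) k x xs →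
                  (k ≢ 0 → P x) → (P x → k ≢ 0) →
                  List.length (filter P? (x ∷ xs)) ≡ 1 ⊓ k + List.length (filter P? xs)
length-filter-∷ P? zero    _ xs _ f = cong List.length (filter-reject P? (λ Px → f Px refl))
length-filter-∷ P? (suc _) _ xs f _ = cong List.length (filter-accept P? (f λ ()))

module _ (d : ℕ) where

  -- The bijection on words

  -- From a part ≡ 1 (mod d + 1), one widening leaves `d` more to the next such part.
  next : ℕ → ℕ
  next zero    = d
  next (suc s) = s

  -- The least s with head (shape w) + s ≡ 1 (mod d + 1).
  deficit : ∀ {m} → Word m → ℕ
  deficit []           = 0
  deficit (widen ∷ w)  = next (deficit w)
  deficit (repeat ∷ w) = deficit w

  adjust : ℕ → Step → Step
  adjust zero    widen  = repeat
  adjust zero    repeat = widen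
  adjust (suc _) a      = a

  adjust-involutive : ∀ s a → adjust s (adjust s a) ≡ a
  adjust-involutive zero    widen  = refl
  adjust-involutive zero    repeat = refl
  adjust-involutive (suc _) _      = refl

  -- The deficit is taken from the word already written, which `untwist` has as its input; so both
  -- apply the same involution at each position.
  twist : ∀ {m} → Word m → Word m
  twist []      = []
  twist (a ∷ w) = adjust (deficit (twist w)) a ∷ twist w

  untwist : ∀ {m} → Word m → Word m
  untwist []      = []
  untwist (b ∷ v) = adjust (deficit v) b ∷ untwist v

  twist-untwist : ∀ {m} (v : Word m) → twist (untwist v) ≡ v
  twist-untwist []      = refl
  twist-untwist (b ∷ v) rewrite twist-untwist v =
    cong (_∷ v) (adjust-involutive (deficit v) b)

  untwist-twist : ∀ {m} (w : Word m) → untwist (twist w) ≡ w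
  untwist-twist []      = refl
  untwist-twist (a ∷ w) =
    cong₂ _∷_ (adjust-involutive (deficit (twist w)) a) (untwist-twist w)

  Word↔Word : ∀ m → Word m ↔ Word m
  Word↔Word m = mk↔ₛ′ twist untwist twist-untwist untwist-twist

  -- The statistic mod′ on words

  #residues : List ℕ → ℕ
  #residues xs = List.length (filter (λ a → ¬? (a % suc d ≟ 1 % suc d)) xs)

  -- Covers only the tail of the shape: the largest part may still grow, and a `repeat` fixes one
  -- copy of it.
  residueCount : ∀ {m} → Word m → ℕ
  residueCount []           = 0
  residueCount (widen ∷ w)  = residueCount w
  residueCount (repeat ∷ w) = 1 ⊓ deficit w + residueCount w

  next≤d : ∀ {s} → s ≤ d → next s ≤ d
  next≤d {zero}  _ = ≤-refl
  next≤d {suc _} p = <⇒≤ p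

  deficit≤d : ∀ {m} (w : Word m) → deficit w ≤ d
  deficit≤d []           = z≤n
  deficit≤d (widen ∷ w)  = next≤d (deficit≤d w)
  deficit≤d (repeat ∷ w) = deficit≤d w

  Completes : ℕ → ℕ → Set
  Completes s c = ∃ λ k → c + s ≡ 1 + k * suc d

  completes-next : ∀ s c → Completes s c → Completes (next s) (suc c)
  -- The value 1 + k(d + 1) is already reached, so the target moves to the next quotient.
  completes-next zero c (k , eq) = suc k , cong suc (begin
    c + d               ≡⟨ cong (_+ d) (trans (sym (+-identityʳ c)) eq) ⟩
    suc (k * suc d + d) ≡⟨ cong suc (+-comm (k * suc d) d) ⟩
    suc k * suc d       ∎)
    where open ≡-Reasoning
  completes-next (suc s) c (k , eq) = k , trans (sym (+-suc c s)) eq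

  completes-deficit : ∀ {m} (w : Word m) → Completes (deficit w) (head (shape w))
  completes-deficit []           = 0 , refl
  completes-deficit (widen ∷ w)  = completes-next (deficit w) _ (completes-deficit w)
  completes-deficit (repeat ∷ w) = completes-deficit w

  completes-zero : ∀ c → Completes 0 c → c % suc d ≡ 1 % suc d
  completes-zero c (k , eq) =
    trans (cong (_% suc d) (trans (sym (+-identityʳ c)) eq)) ([m+kn]%n≡m%n 1 k (suc d))

  -- Were c ≡ 1, then c + s ≡ 0 would give 1 + s ≡ 0 (mod d + 1), impossible for 0 < 1 + s ≤ d.
  completes-suc : ∀ s c → suc s ≤ d → Completes (suc s) c → c % suc d ≢ 1 % suc d
  completes-suc s c s<d (k , eq) c≡1 = contradiction absurd λ ()
    where
    open ≡-Reasoning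
    absurd : suc s ≡ 0
    absurd = begin
      suc s                               ≡⟨ m<n⇒m%n≡m (s≤s s<d) ⟨
      (1 + s) % suc d                     ≡⟨ %-distribˡ-+ 1 s (suc d) ⟩
      (1 % suc d + s % suc d) % suc d     ≡⟨ cong (λ r → (r + s % suc d) % suc d) c≡1 ⟨
      (c % suc d + s % suc d) % suc d     ≡⟨ %-distribˡ-+ c s (suc d) ⟨
      (c + s) % suc d                     ≡⟨ cong (_% suc d) (suc-injective (trans (sym (+-suc c s)) eq)) ⟩
      (k * suc d) % suc d                 ≡⟨ m*n%n≡0 k (suc d) ⟩
      0                                   ∎

  #residues-∷ : ∀ s c xs → s ≤ d → Completes s c →
                #residues (c ∷ xs) ≡ 1 ⊓ s + #residues xs
  #residues-∷ s c xs s≤d compl =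
    length-filter-∷ _ s c xs (to s s≤d compl) (λ ≢1 → λ { refl → ≢1 (completes-zero c compl) })
    where
    to : ∀ s → s ≤ d → Completes s c → s ≢ 0 → c % suc d ≢ 1 % suc d
    to zero    _   _     s≢0 = contradiction refl s≢0
    to (suc s) s≤d compl _   = completes-suc s c s≤d compl

  -- Mutual induction: a `repeat` turns the whole former shape into the tail.
  #residues-tail : ∀ {m} (w : Word m) → #residues (tail (shape w)) ≡ residueCount w
  #residues-shape : ∀ {m} (w : Word m) →
                    #residues (toList (shape w)) ≡ 1 ⊓ deficit w + residueCount w

  #residues-tail []           = refl
  #residues-tail (widen ∷ w)  = #residues-tail w
  #residues-tail (repeat ∷ w) = #residues-shape w

  #residues-shape w =
    trans (#residues-∷ (deficit w) _ _ (deficit≤d w) (completes-deficit w))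
          (cong (1 ⊓ deficit w +_) (#residues-tail w))

  -- The statistic dif on words

  #gaps : List ℕ → ℕ
  #gaps []       = 0
  #gaps (x ∷ xs) = List.length (filter (λ (a , b) → a ∸ b <? d) (zip (x ∷ xs) xs))

  -- The number of widenings needed before the first gap of shape w reaches d
  -- (none if there is a single part).
  gap : ∀ {m} → Word m → ℕ
  gap []           = 0
  gap (widen ∷ w)  = pred (gap w)
  gap (repeat ∷ w) = d

  gapCount : ∀ {m} → Word m → ℕ
  gapCount []           = 0
  gapCount (widen ∷ w)  = gapCount w
  gapCount (repeat ∷ w) = 1 ⊓ gap w + gapCount w

  -- The shortfall of the first gap from `d`, positive exactly when `dif` counts that gap.
  firstGap : List⁺ ℕ → ℕ
  firstGap (_ ∷ [])    = 0
  firstGap (c ∷ x ∷ _) = d ∸ (c ∸ x)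

  firstGap-widen : ∀ xs → Linked _≥_ (toList xs) →
                   firstGap (grow widen xs) ≡ pred (firstGap xs)
  firstGap-widen (_ ∷ [])    _       = refl
  firstGap-widen (c ∷ x ∷ _) (q ∷ _) =
    trans (cong (d ∸_) (+-∸-assoc 1 q)) (sym (pred[m∸n]≡m∸[1+n] d (c ∸ x)))

  firstGap-repeat : ∀ xs → firstGap (grow repeat xs) ≡ d
  firstGap-repeat (c ∷ _) = cong (d ∸_) (n∸n≡0 c)

  firstGap-shape : ∀ {m} (w : Word m) → firstGap (shape w) ≡ gap w
  firstGap-shape []           = refl
  firstGap-shape (widen ∷ w)  =
    trans (firstGap-widen (shape w) (shape-decreasing w)) (cong pred (firstGap-shape w))
  firstGap-shape (repeat ∷ w) = firstGap-repeat (shape w)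

  #gaps-∷ : ∀ xs → #gaps (toList xs) ≡ 1 ⊓ firstGap xs + #gaps (tail xs)
  #gaps-∷ (_ ∷ [])     = refl
  #gaps-∷ (c ∷ x ∷ xs) = length-filter-∷ _ (d ∸ (c ∸ x)) (c , x) (zip (x ∷ xs) xs)
    (λ ≢0 → ≰⇒> (≢0 ∘ m≤n⇒m∸n≡0)) m>n⇒m∸n≢0

  #gaps-tail : ∀ {m} (w : Word m) → #gaps (tail (shape w)) ≡ gapCount w
  #gaps-shape : ∀ {m} (w : Word m) → #gaps (toList (shape w)) ≡ 1 ⊓ gap w + gapCount w

  #gaps-tail []           = refl
  #gaps-tail (widen ∷ w)  = #gaps-tail w
  #gaps-tail (repeat ∷ w) = #gaps-shape w

  #gaps-shape w = trans (#gaps-∷ (shape w))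
    (cong₂ (λ g k → 1 ⊓ g + k) (firstGap-shape w) (#gaps-tail w))

  -- Comparison of the two statistics

  -- Reading `widen` takes both deficit and gap to their predecessors; reading `repeat` resets the
  -- gap to `d`, the largest possible deficit. A `repeat` written at positive deficit is also read
  -- as `repeat`, at positive gap, so both counts grow.
  twist-≤ : ∀ {m} (w : Word m) →
            deficit (twist w) ≤ gap w × residueCount (twist w) ≤ gapCount w
  twist-≤ [] = z≤n , z≤n
  twist-≤ (widen ∷ w) with deficit (twist w) in eq | twist-≤ w
  ... | zero  | _ , r≤ rewrite eq = z≤n , r≤
  ... | suc s | s≤ , r≤ rewrite eq = pred-mono-≤ s≤ , r≤
  twist-≤ (repeat ∷ w) with deficit (twist w) in eq | twist-≤ w | deficit≤d (twist w)
  ... | zero  | _ , r≤  | _ rewrite eq = ≤-refl , m≤n⇒m≤o+n (1 ⊓ gap w) r≤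
  ... | suc s | s≤ , r≤ | s≤d rewrite eq = s≤d , +-mono-≤ (⊓-monoʳ-≤ 1 s≤) r≤

  -- Equality can be lost only at a `repeat` read with positive deficit, and that makes
  -- `residueCount` positive.
  twist-≡ : ∀ {m} (w : Word m) → residueCount (twist w) ≡ 0 →
            deficit (twist w) ≡ gap w × gapCount w ≡ 0
  twist-≡ [] _ = refl , refl
  twist-≡ (widen ∷ w) with deficit (twist w) in eq | twist-≡ w
  ... | zero  | ih rewrite eq = λ r≡0 → cong pred (proj₁ (ih r≡0)) , proj₂ (ih r≡0)
  ... | suc s | ih rewrite eq = λ r≡0 → cong pred (proj₁ (ih r≡0)) , proj₂ (ih r≡0)
  twist-≡ (repeat ∷ w) with deficit (twist w) in eq | twist-≡ w
  ... | zero  | ih rewrite eq = λ r≡0 →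
    -- The gap equals the deficit 0, so the gap just closed is not counted.
    refl , cong₂ (λ g k → 1 ⊓ g + k) (sym (proj₁ (ih r≡0))) (proj₂ (ih r≡0))
  ... | suc s | ih rewrite eq = λ ()

  #residues≤#gaps : ∀ {m} (w : Word m) →
                    #residues (toList (shape (twist w))) ≤ #gaps (toList (shape w))
  #residues≤#gaps w rewrite #residues-shape (twist w) | #gaps-shape w =
    +-mono-≤ (⊓-monoʳ-≤ 1 (proj₁ (twist-≤ w))) (proj₂ (twist-≤ w))

  -- With no completed part counted, deficit and gap agree, so the largest part and the first gap
  -- contribute equally.
  #residues≡0⇒#gaps≡0 : ∀ {m} (w : Word m) → #residues (toList (shape (twist w))) ≡ 0 →
                        #gaps (toList (shape w)) ≡ 0
  #residues≡0⇒#gaps≡0 w eq rewrite #residues-shape (twist w) | #gaps-shape w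
    with s≡g , k≡0 ← twist-≡ w (m+n≡0⇒n≡0 (1 ⊓ deficit (twist w)) eq)
    rewrite k≡0 | sym s≡g = trans (+-identityʳ _) (m+n≡0⇒m≡0 _ eq)

theorem3p6 : (d n : ℕ) → d ≥ 1 → n ≥ 1 →
    Σ (H n ⤖ H n) λ φ →
    ((p : H n) → dif d (proj₁ p) ≥ mod′ d (proj₁ (Bijection.to φ p))) ×
    ((p : H n) → dif d (proj₁ p) ≡ 0 ⇔ mod′ d (proj₁ (Bijection.to φ p)) ≡ 0)
theorem3p6 d (suc m) _ _ = ↔⇒⤖ φ , mod≤dif , λ p →
    -- This direction is the inequality alone; the converse rests on `twist-≡`.
    mk⇔ (λ dif≡0 → n≤0⇒n≡0 (subst (mod′ d (proj₁ (Inverse.to φ p)) ≤_) dif≡0 (mod≤dif p)))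
        (mod≡0⇒dif≡0 p)
  where
  module W = Inverse (Word↔H m)

  φ : H (suc m) ↔ H (suc m)
  φ = Word↔H m ↔-∘ (Word↔Word d m ↔-∘ ↔-sym (Word↔H m))

  from-word : ∀ p → dif d (proj₁ (W.to (W.from p))) ≡ dif d (proj₁ p)
  from-word p = cong (dif d ∘ proj₁) (W.strictlyInverseˡ p)

  mod≤dif : ∀ p → mod′ d (proj₁ (Inverse.to φ p)) ≤ dif d (proj₁ p)
  mod≤dif p = subst (mod′ d (proj₁ (Inverse.to φ p)) ≤_) (from-word p) (#residues≤#gaps d (W.from p))

  mod≡0⇒dif≡0 : ∀ p → mod′ d (proj₁ (Inverse.to φ p)) ≡ 0 → dif d (proj₁ p) ≡ 0
  mod≡0⇒dif≡0 p eq = trans (sym (from-word p)) (#residues≡0⇒#gaps≡0 d (W.from p) eq)
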